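{- Let $(\Gamma,\alpha)$ be an abstract 1-skeleton of type $(k,n)$ such that $\alpha$ is $l$-independent, where $1<l\le k$. Then for every vertex $p\in V_\Gamma$, any $m$ $(<l)$ edges $e_1,\dots,e_m$ of $E_p$ can be extended to a unique $m$-face, i.e. there is exactly one $m$-dimensional face of $(\Gamma,\alpha)$ containing $e_1,\dots,e_m$. In particular, when $k=n$, for every $p\in V_\Gamma$ any $m$ $(\le n)$ edges of $E_p$ can always be extended to a unique $m$-face.
   Context: Let $G=(\mathbb{Z}_2)^k$, $k\ge1$. $\mathrm{Hom}(G,\mathbb{Z}_2)$ is regarded as a $k$-dimensional vector space over $\mathbb{Z}_2$ with zero element $\rho_0$. An abstract 1-skeleton of type $(k,n)$ (with $n\ge k$) is a pair $(\Gamma,\alpha)$ where $\Gamma$ is a finite $n$-valent regular graph without loops (multiple edges allowed), with vertex set $V_\Gamma$ and edge set $E_\Gamma$, and $\alpha:E_\Gamma\to\mathrm{Hom}(G,\mathbb{Z}_2)\setminus\{\rho_0\}$ is a map such that, with $E_p$ the set of edges adjacent to the vertex $p$ and $\alpha(E_p)$ the multiset of values of $\alpha$ on $E_p$: (1) for each $p\in V_\Gamma$, $\alpha(E_p)$ spans $\mathrm{Hom}(G,\mathbb{Z}_2)$; (2) for each edge $e$ with endpoints $p,q$, $\alpha(E_p)\equiv\alpha(E_q)\bmod\alpha(e)$, i.e. the two multisets have the same image in $\mathrm{Hom}(G,\mathbb{Z}_2)/\langle\alpha(e)\rangle$. $\alpha$ is $l$-independent if for each vertex $p$ the colors of any $l$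 distinct edges in $E_p$ are linearly independent in $\mathrm{Hom}(G,\mathbb{Z}_2)$. For $0\le\ell\le n$, an $\ell$-dimensional face ($\ell$-face) of $(\Gamma,\alpha)$ is a pair $(\Gamma',\alpha|_{\Gamma'})$ with $\Gamma'$ a connected $\ell$-valent subgraph of $\Gamma$ for which there is a subspace $K$ of $\mathrm{Hom}(G,\mathbb{Z}_2)$ such that (writing $E_p|_{\Gamma'}$ for the edges of $\Gamma'$ adjacent to $p$) (1) for each vertex $p\in V_{\Gamma'}$, $\alpha(E_p|_{\Gamma'})$ spans $K$, and (2) for each edge $e=pq$ of $\Gamma'$, $\alpha(E_p|_{\Gamma'})\equiv\alpha(E_q|_{\Gamma'})\bmod\alpha(e)$ as multisets. -}

module Defs where

open import Algebra.Bundles using (AbelianGroup; CommutativeRing; Group)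
open import Algebra.Definitions.RawMonoid using (sum)
import Algebra.Construct.Pointwise as Pointwise
open import Algebra.Module.Bundles using (Module)
open import Algebra.Module.Structures.Biased using (IsModuleFromLeft)
open import Algebra.Morphism.Bundles using (GroupHomomorphism)
open import Data.Fin.Base using (Fin)
open import Data.Fin.Properties using (_≟_)
open import Data.Fin.Subset using (Subset; Nonempty; _∈_)
open import Data.Fin.Subset.Properties using (_∈?_)
open import Data.List.Base using (List; allFin; filter; length; lookup; map)
import Data.List.Relation.Binary.Permutation.Setoid as Permutation
open import Data.Nat.Base using (ℕ; _≤_)
open import Data.Parity.Base using (Parity; 0ℙ; _*_)
import Data.Parity.Base as ℙ using (_+_)
import Data.Parity.Properties as ℙₚ
open import Data.Product using (_×_; _,_; ∃; ∃!)
open import Data.Sum.Base using (_⊎_)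
open import Data.Vec.Functional using (Vector)
open import Function.Base using (_∘_)
open import Function.Bundles using (_⇔_)
open import Function.Definitions using (Injective)
open import Level using (0ℓ)
open import Relation.Binary.Bundles using (Setoid)
open import Relation.Binary.Construct.Closure.ReflexiveTransitive using (Star)
open import Relation.Binary.Definitions using (_Respects_)
open import Relation.Binary.PropositionalEquality
  using (_≡_; _≢_; refl; sym; trans; cong; cong₂)
open import Relation.Nullary using (¬_; Dec)
open import Relation.Nullary.Decidable using (_⊎-dec_)
open import Relation.Unary using (Pred; U)

ℤ₂ : CommutativeRing 0ℓ 0ℓ
ℤ₂ = ℙₚ.+-*-commutativeRing

module LinearAlgebra (V : Module ℤ₂ 0ℓ 0ℓ) where
  open Module V

  combination : ∀ {n} → Vector Parity n → Vector Carrierᴹ n → Carrierᴹ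
  combination c v = sum +ᴹ-rawMonoid (λ i → c i *ₗ v i)

  LinearlyIndependent : ∀ {n} → Vector Carrierᴹ n → Set
  LinearlyIndependent v = ∀ c → combination c v ≈ᴹ 0ᴹ → ∀ i → c i ≡ 0ℙ

  record IsSubspace (K : Pred Carrierᴹ 0ℓ) : Set where
    field
      resp     : K Respects _≈ᴹ_
      0-closed : K 0ᴹ
      +-closed : ∀ {x y} → K x → K y → K (x +ᴹ y)
      *-closed : ∀ a {x} → K x → K (a *ₗ x)

  _Spans_ : List Carrierᴹ → Pred Carrierᴹ 0ℓ → Set
  xs Spans K = ∀ x → K x ⇔ ∃ λ c → combination c (lookup xs) ≈ᴹ x

  -- The quotient of V by the line ⟨ z ⟩, as a setoid on the vectors of V.
  quotient : Carrierᴹ → Setoid 0ℓ 0ℓ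
  quotient z = record
    { Carrier       = Carrierᴹ
    ; _≈_           = λ x y → ∃ λ a → x ≈ᴹ y +ᴹ a *ₗ z
    ; isEquivalence = record
      { refl  = 0ℙ , ≈ᴹ-sym (≈ᴹ-trans (+ᴹ-congˡ (*ₗ-zeroˡ z)) (+ᴹ-identityʳ _))
      ; sym   = λ { {x} {y} (a , x≈y+az) → a , ≈ᴹ-sym
          (≈ᴹ-trans (+ᴹ-congʳ x≈y+az)
          (≈ᴹ-trans (combine y a a)
          (≈ᴹ-trans (+ᴹ-congˡ (≈ᴹ-trans (*ₗ-congʳ (ℙₚ.p+p≡0ℙ a)) (*ₗ-zeroˡ z)))
                    (+ᴹ-identityʳ y)))) }
      ; trans = λ { {x} {y} {w} (a , x≈y+az) (b , y≈w+bz) → b ℙ.+ a ,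
          ≈ᴹ-trans x≈y+az (≈ᴹ-trans (+ᴹ-congʳ y≈w+bz) (combine w b a)) }
      }
    }
    where
    combine : ∀ w a b → (w +ᴹ a *ₗ z) +ᴹ b *ₗ z ≈ᴹ w +ᴹ (a ℙ.+ b) *ₗ z
    combine w a b = ≈ᴹ-trans (+ᴹ-assoc w (a *ₗ z) (b *ₗ z))
                             (+ᴹ-congˡ (≈ᴹ-sym (*ₗ-distribʳ z a b)))

  -- Lists stand for multisets: they are compared up to reordering.
  _≋_mod_ : List Carrierᴹ → List Carrierᴹ → Carrierᴹ → Set
  xs ≋ ys mod z = Permutation._↭_ (quotient z) xs ys

-- The raw group +-0-rawGroup of the library has the wrong inverse operation
-- (p ↦ p + 1), so raw groups are taken from +-0-group.
G : ℕ → Group 0ℓ 0ℓ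
G k = Pointwise.group (Fin k) ℙₚ.+-0-group

Hom : ℕ → Set
Hom k = GroupHomomorphism (Group.rawGroup (G k)) (Group.rawGroup ℙₚ.+-0-group)

module _ {k : ℕ} where
  open GroupHomomorphism using (⟦_⟧; ⟦⟧-cong; homo)

  private
    -- Inversion on both groups is the identity and g + g = 0, so additivity
    -- and congruence suffice.
    hom : (f : (Fin k → Parity) → Parity) →
          (∀ {x y} → (∀ i → x i ≡ y i) → f x ≡ f y) →
          (∀ x y → f (λ i → x i ℙ.+ y i) ≡ f x ℙ.+ f y) → Hom k
    hom f f-cong f-+ = record
      { ⟦_⟧ = f
      ; isGroupHomomorphism = record
        { isMonoidHomomorphism = record
          { isMagmaHomomorphism = record
            { isRelHomomorphism = record { cong = f-cong }
            ; homo = f-+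
            }
          ; ε-homo = trans (f-+ (λ _ → 0ℙ) (λ _ → 0ℙ)) (ℙₚ.p+p≡0ℙ (f (λ _ → 0ℙ)))
          }
        ; ⁻¹-homo = λ _ → refl
        }
      }

    module +ₚ = AbelianGroup ℙₚ.+-0-abelianGroup

    interchange : ∀ a b c d → (a ℙ.+ b) ℙ.+ (c ℙ.+ d) ≡ (a ℙ.+ c) ℙ.+ (b ℙ.+ d)
    interchange a b c d = trans (+ₚ.assoc a b (c ℙ.+ d))
      (trans (cong (a ℙ.+_) (trans (sym (+ₚ.assoc b c d))
        (trans (cong (ℙ._+ d) (+ₚ.comm b c)) (+ₚ.assoc c b d))))
      (sym (+ₚ.assoc a c (b ℙ.+ d))))

  infix  4 _≈ₕ_
  infixl 6 _+ₕ_
  infixr 7 _·_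

  _≈ₕ_ : Hom k → Hom k → Set
  ρ ≈ₕ σ = ∀ g → ⟦ ρ ⟧ g ≡ ⟦ σ ⟧ g

  ρ₀ : Hom k
  ρ₀ = hom (λ _ → 0ℙ) (λ _ → refl) (λ _ _ → refl)

  _+ₕ_ : Hom k → Hom k → Hom k
  ρ +ₕ σ = hom (λ g → ⟦ ρ ⟧ g ℙ.+ ⟦ σ ⟧ g)
    (λ g≈h → cong₂ ℙ._+_ (⟦⟧-cong ρ g≈h) (⟦⟧-cong σ g≈h))
    (λ g h → trans (cong₂ ℙ._+_ (homo ρ g h) (homo σ g h))
                   (interchange (⟦ ρ ⟧ g) (⟦ ρ ⟧ h) (⟦ σ ⟧ g) (⟦ σ ⟧ h)))

  _·_ : Parity → Hom k → Hom k
  a · ρ = hom (λ g → a * ⟦ ρ ⟧ g)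
    (λ g≈h → cong (a *_) (⟦⟧-cong ρ g≈h))
    (λ g h → trans (cong (a *_) (homo ρ g h))
                   (ℙₚ.*-distribˡ-+ a (⟦ ρ ⟧ g) (⟦ ρ ⟧ h)))

HomSpace : ℕ → Module ℤ₂ 0ℓ 0ℓ
HomSpace k = record
  { Carrierᴹ = Hom k
  ; _≈ᴹ_     = _≈ₕ_
  ; _+ᴹ_     = _+ₕ_
  ; _*ₗ_     = _·_
  ; _*ᵣ_     = λ ρ a → a · ρ
  ; 0ᴹ       = ρ₀
  ; -ᴹ_      = λ ρ → ρ
  ; isModule = IsModuleFromLeft.isModule record
    { isLeftModule = record
      { isLeftSemimodule = record
        { +ᴹ-isCommutativeMonoid = record
          { isMonoid = record
            { isSemigroup = record
              { isMagma = record
                { isEquivalence = record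
                  { refl  = λ _ → refl
                  ; sym   = λ p g → sym (p g)
                  ; trans = λ p q g → trans (p g) (q g)
                  }
                ; ∙-cong = λ p q g → cong₂ ℙ._+_ (p g) (q g)
                }
              ; assoc = λ ρ σ τ g → ℙₚ.+-assoc (⟦ ρ ⟧ g) (⟦ σ ⟧ g) (⟦ τ ⟧ g)
              }
            ; identity = (λ ρ g → ℙₚ.+-identityˡ (⟦ ρ ⟧ g))
                       , (λ ρ g → ℙₚ.+-identityʳ (⟦ ρ ⟧ g))
            }
          ; comm = λ ρ σ g → ℙₚ.+-comm (⟦ ρ ⟧ g) (⟦ σ ⟧ g)
          }
        ; isPreleftSemimodule = record
          { *ₗ-cong      = λ a≡b p g → cong₂ _*_ a≡b (p g)
          ; *ₗ-zeroˡ     = λ _ _ → refl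
          ; *ₗ-distribʳ  = λ ρ a b g → ℙₚ.*-distribʳ-+ (⟦ ρ ⟧ g) a b
          ; *ₗ-identityˡ = λ _ _ → refl
          ; *ₗ-assoc     = λ a b ρ g → ℙₚ.*-assoc a b (⟦ ρ ⟧ g)
          ; *ₗ-zeroʳ     = λ a _ → ℙₚ.*-zeroʳ a
          ; *ₗ-distribˡ  = λ a ρ σ g → ℙₚ.*-distribˡ-+ a (⟦ ρ ⟧ g) (⟦ σ ⟧ g)
          }
        }
      ; -ᴹ‿cong    = λ p → p
      ; -ᴹ‿inverse = (λ ρ g → ℙₚ.p+p≡0ℙ (⟦ ρ ⟧ g))
                   , (λ ρ g → ℙₚ.p+p≡0ℙ (⟦ ρ ⟧ g))
      }
    }
  }
  where open GroupHomomorphism using (⟦_⟧)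

-- Edges are unoriented: everything below is symmetric in the two endpoints,
-- so the choice of which one is called source is immaterial.
record Graph : Set where
  field
    #vertices #edges : ℕ

  Vertex = Fin #vertices
  Edge   = Fin #edges

  field
    source target : Edge → Vertex
    loopless      : ∀ e → source e ≢ target e

  Incident : Vertex → Edge → Set
  Incident p e = p ≡ source e ⊎ p ≡ target e

  incident? : ∀ p e → Dec (Incident p e)
  incident? p e = (p ≟ source e) ⊎-dec (p ≟ target e)

  edgesAt : Vertex → List Edge
  edgesAt p = filter (incident? p) (allFin #edges)

  Joins : Edge → Vertex → Vertex → Set
  Joins e p q = (source e ≡ p × target e ≡ q) ⊎ (source e ≡ q × target e ≡ p)

record Subgraph (Γ : Graph) : Set where
  open Graph Γ
  field
    vertices : Subset #vertices
    edges    : Subset #edges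
    source∈  : ∀ {e} → e ∈ edges → source e ∈ vertices
    target∈  : ∀ {e} → e ∈ edges → target e ∈ vertices

  edgesAt∣ : Vertex → List Edge
  edgesAt∣ p = filter (_∈? edges) (edgesAt p)

  Adjacent : Vertex → Vertex → Set
  Adjacent p q = ∃ λ e → e ∈ edges × Joins e p q

  Connected : Set
  Connected = Nonempty vertices × (∀ {p q} → p ∈ vertices → q ∈ vertices → Star Adjacent p q)

  Regular : ℕ → Set
  Regular d = ∀ {p} → p ∈ vertices → length (edgesAt∣ p) ≡ d

_≈ˢ_ : {Γ : Graph} → Subgraph Γ → Subgraph Γ → Set
A ≈ˢ B = Subgraph.vertices A ≡ Subgraph.vertices B × Subgraph.edges A ≡ Subgraph.edges B

record AbstractSkeleton (k n : ℕ) : Set where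
  open LinearAlgebra (HomSpace k)
  field
    k≤n : k ≤ n
    Γ   : Graph

  open Graph Γ public

  field
    regular   : ∀ p → length (edgesAt p) ≡ n
    α         : Edge → Hom k
    α≉ρ₀      : ∀ e → ¬ α e ≈ₕ ρ₀
    spanning  : ∀ p → map α (edgesAt p) Spans U
    congruent : ∀ e → map α (edgesAt (source e)) ≋ map α (edgesAt (target e)) mod α e

module _ {k n : ℕ} (S : AbstractSkeleton k n) where
  open AbstractSkeleton S
  open LinearAlgebra (HomSpace k)

  Independent : ℕ → Set
  Independent l = ∀ p (es : Fin l → Edge) → Injective _≡_ _≡_ es →
                  (∀ i → Incident p (es i)) → LinearlyIndependent (α ∘ es)

  record IsFace (d : ℕ) (F : Subgraph Γ) : Set₁ where
    open Subgraph F
    field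
      connected  : Connected
      d-valent   : Regular d
      K          : Pred (Hom k) 0ℓ
      isSubspace : IsSubspace K
      spanning∣  : ∀ {p} → p ∈ vertices → map α (edgesAt∣ p) Spans K
      congruent∣ : ∀ {e} → e ∈ edges →
                   map α (edgesAt∣ (source e)) ≋ map α (edgesAt∣ (target e)) mod α e

  -- For m ≥ 1 a subgraph containing the given edges contains p automatically;
  -- requiring p to lie in the face only matters for m = 0, where the face is
  -- to be the vertex p itself.
  ExtendsToUniqueFace : ∀ {m} → Vertex → (Fin m → Edge) → Set₁
  ExtendsToUniqueFace {m} p es = ∃! _≈ˢ_ λ F →
    IsFace m F × p ∈ Subgraph.vertices F × (∀ i → es i ∈ Subgraph.edges F)

{-# OPTIONS --safe #-}

-- Let K be the span of α(e₁), …, α(eₘ), and suppose that e₁, …, eₘ are the only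
-- edges at p with colour in K; this holds if any m + 1 edges at p have independent
-- colours, or if m = n. Along an edge e with α(e) ∈ K, congruence modulo α(e)
-- preserves the number of edges at the endpoint with colour in K, as well as the
-- span of their colours. So the component of p in the graph of all edges with
-- colour in K is an m-face. Conversely, an m-face F containing p and the eᵢ has
-- exactly these edges at p, so its subspace is contained in K; counting edges at
-- each vertex of F then shows that F contains every edge at that vertex with
-- colour in K, so F is that component.
-- If k = n, the n colours at a vertex span a space of dimension n, hence they are
-- independent, which reduces m < n to the first case.
module Submission where

open import Algebra.Module.Bundles using (Module)
open import Algebra.Morphism.Bundles using (GroupHomomorphism)
import Algebra.Properties.CommutativeMonoid.Sum as CommutativeMonoidSum
open import Data.Bool.Base using (true; false)
open import Data.Fin.Base using (Fin; zero; suc; combine; finToFun; funToFin)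
open import Data.Fin.Properties
  using (_≟_; any?; all?; injective⇒≤; finToFun-funToFin; funToFin-finToFin;
         suc-injective)
open import Data.Fin.Subset using (Subset; ⁅_⁆; _∪_; _⊃_)
  renaming (_∈_ to _∈ˢ_; _⊆_ to _⊆ˢ_)
open import Data.Fin.Subset.Induction using (⊃-wellFounded; Acc; acc)
open import Data.Fin.Subset.Properties
  using (_∈?_; x∈⁅x⁆; x∈⁅y⁆⇒x≡y; ⊆-antisym; p⊆p∪q; q⊆p∪q; x∈p∪q⁻)
open import Data.List.Base as List
  using (List; []; _∷_; allFin; filter; length; lookup; map)
open import Data.List.Membership.Propositional using (_∈_)
open import Data.List.Membership.Propositional.Properties
  using (∈-lookup; ∈-tabulate⁺; ∈-tabulate⁻; ∈-filter⁺; ∈-filter⁻; ∈-allFin; ∈-map⁺; ∈-map⁻)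
import Data.List.Membership.Setoid.Properties as SetoidMembership
open import Data.List.Properties using (length-map; length-tabulate)
import Data.List.Relation.Binary.Permutation.Setoid as Permutation
import Data.List.Relation.Binary.Permutation.Setoid.Properties as PermutationProperties
open import Data.List.Relation.Binary.Subset.Propositional using (_⊆_)
open import Data.List.Relation.Unary.All as All using (_∷_)
import Data.List.Relation.Unary.All.Properties as All
open import Data.List.Relation.Unary.Any as Any using (here; there; index)
open import Data.List.Relation.Unary.Any.Properties using (lookup-index)
open import Data.List.Relation.Unary.Unique.Propositional using (Unique; _∷_)
import Data.List.Relation.Unary.Unique.Propositional.Properties as Unique
open import Data.Nat.Base using (ℕ; zero; suc; _≤_; _<_; _^_; _≤′_; ≤′-refl; ≤′-step)
open import Data.Nat.Properties
  using (≤-refl; ≤-reflexive; ≤-trans; ≤-antisym; <⇒≤; <⇒≱; ≤⇒≤′; m≤n⇒m<n∨m≡n)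
open import Data.Parity.Base using (Parity; 0ℙ; 1ℙ; _*_)
import Data.Parity.Base as ℙ using (_+_)
import Data.Parity.Properties as ℙₚ
open import Data.Product using (_×_; _,_; ∃; proj₁; proj₂)
open import Data.Sum.Base using (_⊎_; inj₁; inj₂; swap)
open import Data.Vec.Base using (tabulate)
open import Data.Vec.Functional as Vector using (Vector)
open import Data.Vec.Properties using ([]=⇒lookup; lookup⇒[]=; lookup∘tabulate)
open import Function.Base using (_∘_; id)
open import Function.Bundles using (_⇔_; mk⇔; Equivalence)
open import Function.Definitions using (Injective)
open import Level using (0ℓ)
open import Relation.Binary.Bundles using (Setoid)
open import Relation.Binary.Construct.Closure.ReflexiveTransitive as Star
  using (Star; ε; _◅_; _◅◅_)
open import Relation.Binary.Definitions using (DecidableEquality; Symmetric)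
  renaming (Decidable to Decidable₂)
open import Relation.Binary.PropositionalEquality
  using (_≡_; _≢_; _≗_; refl; sym; trans; cong; cong₂; subst; subst₂)
open import Relation.Nullary using (¬_; Dec; yes; no; does; contradiction)
open import Relation.Nullary.Decidable
  using (map′; _×-dec_; _⊎-dec_; ¬?; decidable-stable; dec-true)
open import Relation.Unary using (Pred; Decidable)
open import Defs

-- Counting in duplicate-free lists, and filters.

module _ {A : Set} where

  Unique⇒lookup-injective : ∀ {xs : List A} → Unique xs → Injective _≡_ _≡_ (lookup xs)
  Unique⇒lookup-injective (_ ∷ _)  {zero}  {zero}  _  = refl
  Unique⇒lookup-injective (x∉ ∷ _) {zero}  {suc j} eq = contradiction eq (All.lookup x∉ (∈-lookup j))
  Unique⇒lookup-injective (x∉ ∷ _) {suc i} {zero}  eq = contradiction (sym eq) (All.lookup x∉ (∈-lookup i))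
  Unique⇒lookup-injective (_ ∷ u)  {suc i} {suc j} eq = cong suc (Unique⇒lookup-injective u eq)

  Unique∧⊆⇒length≤ : ∀ {xs ys : List A} → Unique xs → xs ⊆ ys → length xs ≤ length ys
  Unique∧⊆⇒length≤ {xs} {ys} u xs⊆ys = injective⇒≤ {f = f} λ {i} {j} eq →
    Unique⇒lookup-injective u
      (trans (lookup-index (sub i)) (trans (cong (lookup ys) eq) (sym (lookup-index (sub j)))))
    where
    sub : ∀ i → lookup xs i ∈ ys
    sub i = xs⊆ys (∈-lookup i)
    f : Fin (length xs) → Fin (length ys)
    f i = index (sub i)

  -- If some `y` of `ys` were missing from `xs`, then `y ∷ xs` would be a duplicate-free list inside
  -- `ys` and longer than `ys`.
  Unique∧⊆∧length≥⇒⊇ : DecidableEquality A → ∀ {xs ys : List A} → Unique xs → xs ⊆ ys →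
                       length ys ≤ length xs → ys ⊆ xs
  Unique∧⊆∧length≥⇒⊇ _≟ᴬ_ {xs} {ys} u xs⊆ys len {y} y∈ys =
    decidable-stable (Any.any? (y ≟ᴬ_) xs) λ y∉xs →
      <⇒≱ (Unique∧⊆⇒length≤ (All.¬Any⇒All¬ xs y∉xs ∷ u) λ
             { (here refl) → y∈ys ; (there x∈xs) → xs⊆ys x∈xs })
          len

  -- Pigeonhole in the form used below: `m` distinct edges in a list of at most `m` edges exhaust
  -- that list.
  injective⇒covers : DecidableEquality A → ∀ {m} {f : Fin m → A} → Injective _≡_ _≡_ f →
                     ∀ {ys} → (∀ i → f i ∈ ys) → length ys ≤ m →
                     ∀ {y} → y ∈ ys → ∃ λ i → y ≡ f i
  injective⇒covers _≟ᴬ_ {m} {f} inj f∈ys len y∈ys =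
    ∈-tabulate⁻ (Unique∧⊆∧length≥⇒⊇ _≟ᴬ_ (Unique.tabulate⁺ inj)
      (λ x∈ → let i , x≡fi = ∈-tabulate⁻ x∈ in subst (_∈ _) (sym x≡fi) (f∈ys i))
      (≤-trans len (≤-reflexive (sym (length-tabulate f)))) y∈ys)

  covers⇒length≤ : ∀ {m} {f : Fin m → A} {ys} → Unique ys →
                   (∀ {y} → y ∈ ys → ∃ λ i → y ≡ f i) → length ys ≤ m
  covers⇒length≤ {f = f} u cov = ≤-trans
    (Unique∧⊆⇒length≤ u λ y∈ → let i , y≡fi = cov y∈ in
      subst (_∈ List.tabulate f) (sym y≡fi) (∈-tabulate⁺ i))
    (≤-reflexive (length-tabulate f))

  injective⇒length≥ : ∀ {m} {f : Fin m → A} {ys} → Injective _≡_ _≡_ f → (∀ i → f i ∈ ys) →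
                      m ≤ length ys
  injective⇒length≥ {f = f} inj f∈ys = ≤-trans (≤-reflexive (sym (length-tabulate f)))
    (Unique∧⊆⇒length≤ (Unique.tabulate⁺ inj) λ x∈ →
      let i , x≡fi = ∈-tabulate⁻ x∈ in subst (_∈ _) (sym x≡fi) (f∈ys i))

  ∷-injective-family : ∀ {m} {x : A} {f : Fin m → A} → (∀ i → x ≢ f i) → Injective _≡_ _≡_ f →
                       Injective _≡_ _≡_ (x Vector.∷ f)
  ∷-injective-family x∉ inj {zero}  {zero}  _  = refl
  ∷-injective-family x∉ inj {zero}  {suc j} eq = contradiction eq (x∉ j)
  ∷-injective-family x∉ inj {suc i} {zero}  eq = contradiction (sym eq) (x∉ i)
  ∷-injective-family x∉ inj {suc i} {suc j} eq = cong suc (inj eq)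

  filter-cong : ∀ {P Q : Pred A 0ℓ} (P? : Decidable P) (Q? : Decidable Q) {xs} →
                (∀ {x} → x ∈ xs → P x ⇔ Q x) → filter P? xs ≡ filter Q? xs
  filter-cong P? Q? {[]}     P⇔Q = refl
  filter-cong P? Q? {x ∷ xs} P⇔Q with P? x | Q? x
  ... | yes _  | yes _  = cong (x ∷_) (filter-cong P? Q? (P⇔Q ∘ there))
  ... | yes Px | no ¬Qx = contradiction (Equivalence.to (P⇔Q (here refl)) Px) ¬Qx
  ... | no ¬Px | yes Qx = contradiction (Equivalence.from (P⇔Q (here refl)) Qx) ¬Px
  ... | no _   | no _   = filter-cong P? Q? (P⇔Q ∘ there)

  filter-map : ∀ {B : Set} {P : Pred B 0ℓ} (P? : Decidable P) (f : A → B) xs →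
               filter P? (map f xs) ≡ map f (filter (P? ∘ f) xs)
  filter-map P? f []       = refl
  filter-map P? f (x ∷ xs) with does (P? (f x))
  ... | true  = cong (f x ∷_) (filter-map P? f xs)
  ... | false = filter-map P? f xs

-- Subsets cut out by decidable predicates, and reachable sets of a finite relation.

module _ {n} {P : Pred (Fin n) 0ℓ} (P? : Decidable P) where

  ⟪_⟫ : Subset n
  ⟪_⟫ = tabulate (does ∘ P?)

  ∈⟪⟫⁺ : ∀ {i} → P i → i ∈ˢ ⟪_⟫
  ∈⟪⟫⁺ {i} Pi = lookup⇒[]= i _ (trans (lookup∘tabulate _ i) (dec-true (P? i) Pi))

  ∈⟪⟫⁻ : ∀ {i} → i ∈ˢ ⟪_⟫ → P i
  ∈⟪⟫⁻ {i} i∈ with P? i | trans (sym (lookup∘tabulate (does ∘ P?) i)) ([]=⇒lookup i∈)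
  ... | yes Pi | _  = Pi
  ... | no  _  | ()

module _ {n} {R : Fin n → Fin n → Set} (R? : Decidable₂ R) (p : Fin n) where

  -- The last two conditions bound `S` from above and from below, so `S` is exactly the set of
  -- points reachable from `p`.
  IsComponent : Subset n → Set
  IsComponent S = p ∈ˢ S × (∀ {q} → q ∈ˢ S → Star R p q) × (∀ {q r} → q ∈ˢ S → R q r → r ∈ˢ S)

  component : ∃ IsComponent
  component = grow ⁅ p ⁆ (⊃-wellFounded _) (x∈⁅x⁆ p)
                   λ q∈ → subst (Star R p) (sym (x∈⁅y⁆⇒x≡y p q∈)) ε
    where
    -- As long as some step of `R` leaves `S`, its endpoint is adjoined. This stops because a subset
    -- of a finite set cannot grow strictly forever.
    grow : ∀ S → Acc _⊃_ S → p ∈ˢ S → (∀ {q} → q ∈ˢ S → Star R p q) → ∃ IsComponent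
    grow S (acc rec) p∈S sound
      with any? (λ q → any? (λ r → (q ∈? S) ×-dec R? q r ×-dec ¬? (r ∈? S)))
    ... | yes (q , r , q∈S , Rqr , r∉S) =
      grow (S ∪ ⁅ r ⁆) (rec (p⊆p∪q _ , r , q⊆p∪q S _ (x∈⁅x⁆ r) , r∉S)) (p⊆p∪q _ p∈S)
        λ s∈ → sound′ (x∈p∪q⁻ S ⁅ r ⁆ s∈)
      where
      sound′ : ∀ {s} → s ∈ˢ S ⊎ s ∈ˢ ⁅ r ⁆ → Star R p s
      sound′ (inj₁ s∈S) = sound s∈S
      sound′ (inj₂ s∈r) = subst (Star R p) (sym (x∈⁅y⁆⇒x≡y r s∈r)) (sound q∈S ◅◅ Rqr ◅ ε)
    ... | no ¬exit = S , p∈S , sound , λ {q} {r} q∈S Rqr →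
      decidable-stable (r ∈? S) λ r∉S → ¬exit (q , r , q∈S , Rqr , r∉S)

-- Vectors over ℤ₂ as a finite set.

bit : Fin 2 → Parity
bit zero       = 0ℙ
bit (suc zero) = 1ℙ

bit⁻¹ : Parity → Fin 2
bit⁻¹ 0ℙ = zero
bit⁻¹ 1ℙ = suc zero

bit∘bit⁻¹ : ∀ a → bit (bit⁻¹ a) ≡ a
bit∘bit⁻¹ 0ℙ = refl
bit∘bit⁻¹ 1ℙ = refl

bit⁻¹∘bit : ∀ i → bit⁻¹ (bit i) ≡ i
bit⁻¹∘bit zero       = refl
bit⁻¹∘bit (suc zero) = refl

funToFin-cong : ∀ {m n} {f g : Fin m → Fin n} → f ≗ g → funToFin f ≡ funToFin g
funToFin-cong {zero}  f≗g = refl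
funToFin-cong {suc m} f≗g = cong₂ combine (f≗g zero) (funToFin-cong (f≗g ∘ suc))

-- Vectors are functions and are compared pointwise; numbering them by `Fin (2 ^ n)` makes search
-- and counting available. The round trip through the number returns a vector only up to `≗`, so
-- predicates and maps on vectors have to respect `≗`.
encode : ∀ {n} → Vector Parity n → Fin (2 ^ n)
encode c = funToFin (bit⁻¹ ∘ c)

decode : ∀ {n} → Fin (2 ^ n) → Vector Parity n
decode i = bit ∘ finToFun i

decode∘encode : ∀ {n} (c : Vector Parity n) → decode (encode c) ≗ c
decode∘encode c i = trans (cong bit (finToFun-funToFin (bit⁻¹ ∘ c) i)) (bit∘bit⁻¹ (c i))

encode∘decode : ∀ {n} (i : Fin (2 ^ n)) → encode {n} (decode i) ≡ i
encode∘decode {n} i = trans (funToFin-cong {n} (bit⁻¹∘bit ∘ finToFun i)) (funToFin-finToFin {n} i)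

encode-cong : ∀ {n} {c d : Vector Parity n} → c ≗ d → encode c ≡ encode d
encode-cong c≗d = funToFin-cong (cong bit⁻¹ ∘ c≗d)

encode-injective : ∀ {n} {c d : Vector Parity n} → encode c ≡ encode d → c ≗ d
encode-injective {c = c} {d} eq i =
  trans (sym (decode∘encode c i)) (trans (cong (λ j → decode j i) eq) (decode∘encode d i))

decode-injective : ∀ {n} {i j : Fin (2 ^ n)} → decode {n} i ≗ decode j → i ≡ j
decode-injective {n} {i} {j} eq =
  trans (sym (encode∘decode {n} i)) (trans (encode-cong eq) (encode∘decode {n} j))

module _ {n} {P : Pred (Vector Parity n) 0ℓ} (resp : ∀ {c d} → c ≗ d → P c → P d)
         (P? : Decidable P) where

  ∃-parity? : Dec (∃ P)
  ∃-parity? = map′ (λ (i , Pi) → decode i , Pi)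
                   (λ (c , Pc) → encode c , resp (sym ∘ decode∘encode c) Pc)
                   (any? (P? ∘ decode))

  ∀-parity? : Dec (∀ c → P c)
  ∀-parity? = map′ (λ Pi c → resp (decode∘encode c) (Pi (encode c)))
                   (λ Pc → Pc ∘ decode)
                   (all? (P? ∘ decode))

module _ {n} (f : Vector Parity n → Vector Parity n)
         (f-cong : ∀ {c d} → c ≗ d → f c ≗ f d) (g : Vector Parity n → Vector Parity n)
         (f∘g : ∀ w → f (g w) ≗ w) where

  -- The right inverse `g` is injective, so by counting its values are all vectors. Hence `c` and
  -- `d` are values of `g`, and applying `f` recovers the arguments they come from.
  surjective⇒injective : ∀ {c d} → f c ≗ f d → c ≗ d
  surjective⇒injective {c} {d} fc≗fd =
    let i , c≡ = covered c
        j , d≡ = covered d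
        i≡j : i ≡ j
        i≡j = decode-injective {n} λ x → trans (sym (image c≡ x)) (trans (fc≗fd x) (image d≡ x))
    in encode-injective (trans c≡ (trans (cong γ i≡j) (sym d≡)))
    where
    γ : Fin (2 ^ n) → Fin (2 ^ n)
    γ i = encode (g (decode {n} i))

    γ-injective : Injective _≡_ _≡_ γ
    γ-injective {i} {j} eq = decode-injective {n} λ x →
      trans (sym (f∘g (decode i) x))
        (trans (f-cong (encode-injective eq) x) (f∘g (decode j) x))

    covered : ∀ c → ∃ λ i → encode c ≡ γ i
    covered c = injective⇒covers _≟_ γ-injective (λ i → ∈-allFin (γ i))
                  (≤-reflexive (length-tabulate id)) (∈-allFin (encode c))

    image : ∀ {c i} → encode c ≡ γ i → f c ≗ decode i
    image {i = i} eq x = trans (f-cong (encode-injective eq) x) (f∘g (decode i) x)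

-- Spans, and multisets of vectors modulo a line.

module Spans (V : Module ℤ₂ 0ℓ 0ℓ) where
  open Module V
  open LinearAlgebra V
  open CommutativeMonoidSum +ᴹ-commutativeMonoid using (sum-cong-≋; ∑-distrib-+)

  Span : ∀ {n} → Vector Carrierᴹ n → Pred Carrierᴹ 0ℓ
  Span v x = ∃ λ c → combination c v ≈ᴹ x

  combination-congˡ : ∀ {n} {c d : Vector Parity n} (v : Vector Carrierᴹ n) → c ≗ d →
                      combination c v ≈ᴹ combination d v
  combination-congˡ v c≗d = sum-cong-≋ λ i → *ₗ-congʳ (c≗d i)

  combination-0 : ∀ {n} (v : Vector Carrierᴹ n) → combination (λ _ → 0ℙ) v ≈ᴹ 0ᴹ
  combination-0 {zero}  v = ≈ᴹ-refl
  combination-0 {suc n} v =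
    ≈ᴹ-trans (+ᴹ-cong (*ₗ-zeroˡ _) (combination-0 (v ∘ suc))) (+ᴹ-identityˡ 0ᴹ)

  combination-+ : ∀ {n} (c d : Vector Parity n) (v : Vector Carrierᴹ n) →
                  combination (λ i → c i ℙ.+ d i) v ≈ᴹ combination c v +ᴹ combination d v
  combination-+ c d v = ≈ᴹ-trans (sum-cong-≋ λ i → *ₗ-distribʳ (v i) (c i) (d i))
                                 (∑-distrib-+ (λ i → c i *ₗ v i) (λ i → d i *ₗ v i))

  combination-* : ∀ {n} a (c : Vector Parity n) (v : Vector Carrierᴹ n) →
                  combination (λ i → a * c i) v ≈ᴹ a *ₗ combination c v
  combination-* {zero}  a c v = ≈ᴹ-sym (*ₗ-zeroʳ a)
  combination-* {suc n} a c v = ≈ᴹ-trans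
    (+ᴹ-cong (*ₗ-assoc a (c zero) (v zero)) (combination-* a (c ∘ suc) (v ∘ suc)))
    (≈ᴹ-sym (*ₗ-distribˡ a _ _))

  Span-isSubspace : ∀ {n} (v : Vector Carrierᴹ n) → IsSubspace (Span v)
  Span-isSubspace v = record
    { resp     = λ { x≈y (c , eq) → c , ≈ᴹ-trans eq x≈y }
    ; 0-closed = _ , combination-0 v
    ; +-closed = λ { (c , eq) (d , eq′) → _ , ≈ᴹ-trans (combination-+ c d v) (+ᴹ-cong eq eq′) }
    ; *-closed = λ { a (c , eq) → _ , ≈ᴹ-trans (combination-* a c v) (*ₗ-congˡ eq) }
    }

  ∈-Span : ∀ {n} (v : Vector Carrierᴹ n) i → Span v (v i)
  ∈-Span v zero = (1ℙ Vector.∷ λ _ → 0ℙ) ,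
    ≈ᴹ-trans (+ᴹ-cong (*ₗ-identityˡ _) (combination-0 (v ∘ suc))) (+ᴹ-identityʳ _)
  ∈-Span v (suc i) = let c , eq = ∈-Span (v ∘ suc) i in 0ℙ Vector.∷ c ,
    ≈ᴹ-trans (+ᴹ-cong (*ₗ-zeroˡ _) eq) (+ᴹ-identityˡ _)

  Span-minimal : ∀ {K} → IsSubspace K → ∀ {n} {v : Vector Carrierᴹ n} → (∀ i → K (v i)) →
                 ∀ x → Span v x → K x
  Span-minimal {K} sub v∈K _ (c , eq) = resp eq (closed c v∈K)
    where
    open IsSubspace sub
    closed : ∀ {n} (c : Vector Parity n) {v : Vector Carrierᴹ n} → (∀ i → K (v i)) →
             K (combination c v)
    closed {zero}  c v∈K = 0-closed
    closed {suc n} c v∈K = +-closed (*-closed (c zero) (v∈K zero)) (closed (c ∘ suc) (v∈K ∘ suc))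

  ∈⇒Span : ∀ {xs x} → x ∈ xs → Span (lookup xs) x
  ∈⇒Span {xs} x∈xs = subst (Span (lookup xs)) (sym (lookup-index x∈xs)) (∈-Span (lookup xs) (index x∈xs))

  All⇒Span⊆ : ∀ {K xs} → IsSubspace K → (∀ {x} → x ∈ xs → K x) →
              ∀ x → Span (lookup xs) x → K x
  All⇒Span⊆ sub xs⊆K = Span-minimal sub (λ i → xs⊆K (∈-lookup i))

  -- A subspace containing `z` is a union of cosets of ⟨z⟩, so membership in it depends only on the
  -- class modulo `z`.
  resp-mod : ∀ {K} → IsSubspace K → ∀ {z} → K z → ∀ {x y} →
             (∃ λ a → x ≈ᴹ y +ᴹ a *ₗ z) → K y → K x
  resp-mod sub z∈K (a , eq) y∈K = resp (≈ᴹ-sym eq) (+-closed y∈K (*-closed a z∈K))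
    where open IsSubspace sub

  -- By `resp-mod`, a matching of `xs` with `ys` modulo `z` pairs elements of `K` with elements of
  -- `K`, so it restricts to them.
  filter-mod : ∀ {K} (K? : Decidable K) → IsSubspace K → ∀ z {xs ys} → K z →
               xs ≋ ys mod z → filter K? xs ≋ filter K? ys mod z
  filter-mod K? sub z z∈K = PermutationProperties.filter⁺ (quotient z) K?
    λ x≈y → resp-mod sub z∈K (Setoid.sym (quotient z) x≈y)

  length-≋ : ∀ z {xs ys} → xs ≋ ys mod z → length xs ≡ length ys
  length-≋ z = PermutationProperties.xs↭ys⇒|xs|≡|ys| (quotient z)

  -- Each vector of `xs` differs from one of `ys` by a multiple of `z`, and `z` itself occurs in
  -- `ys`.
  Span-mod : ∀ z {xs ys} → xs ≋ ys mod z → z ∈ ys → ∀ x →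
             Span (lookup xs) x → Span (lookup ys) x
  Span-mod z {xs} {ys} xs≋ys z∈ys = Span-minimal sub λ i →
    let x∈ys = PermutationProperties.∈-resp-↭ (quotient z) xs≋ys
                 (SetoidMembership.∈-lookup (quotient z) xs i)
    in resp-mod sub (∈⇒Span z∈ys) (lookup-index x∈ys) (∈-Span (lookup ys) (index x∈ys))
    where sub = Span-isSubspace (lookup ys)

-- The space Hom(G, ℤ₂): decidability and the dual basis.

module _ {k : ℕ} where
  open GroupHomomorphism using (⟦_⟧; ⟦⟧-cong)
  open LinearAlgebra (HomSpace k)
  open Spans (HomSpace k)

  _≈ₕ?_ : Decidable₂ (_≈ₕ_ {k})
  ρ ≈ₕ? σ = ∀-parity? (λ g≗h eq → trans (sym (⟦⟧-cong ρ g≗h)) (trans eq (⟦⟧-cong σ g≗h)))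
                      (λ g → ⟦ ρ ⟧ g ℙₚ.≟ ⟦ σ ⟧ g)

  Span? : ∀ {n} (v : Vector (Hom k) n) → Decidable (Span v)
  Span? v x = ∃-parity? (λ c≗d eq g → trans (sym (combination-congˡ v c≗d g)) (eq g))
                        (λ c → combination c v ≈ₕ? x)

  projection : Fin k → Hom k
  projection i = record
    { ⟦_⟧ = λ g → g i
    ; isGroupHomomorphism = record
      { isMonoidHomomorphism = record
        { isMagmaHomomorphism = record
          { isRelHomomorphism = record { cong = λ g≗h → g≗h i }
          ; homo = λ _ _ → refl
          }
        ; ε-homo = refl
        }
      ; ⁻¹-homo = λ _ → refl
      }
    }

  -- Along `s` the vector `g` is the `i`-th unit vector, so only the `i`-th term survives. Allowing
  -- any `s` lets the induction pass to `s ∘ suc`.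
  combination-projection : ∀ {m} (c : Vector Parity m) (s : Fin m → Fin k) g i →
    (∀ j → j ≢ i → g (s j) ≡ 0ℙ) → g (s i) ≡ 1ℙ →
    ⟦ combination c (projection ∘ s) ⟧ g ≡ c i
  combination-projection c s g zero off on =
    trans (cong₂ ℙ._+_ (trans (cong (c zero *_) on) (ℙₚ.*-identityʳ (c zero)))
                       (vanish (c ∘ suc) (s ∘ suc) λ j → off (suc j) λ ()))
          (ℙₚ.+-identityʳ (c zero))
    where
    vanish : ∀ {m} (c : Vector Parity m) (s : Fin m → Fin k) → (∀ j → g (s j) ≡ 0ℙ) →
             ⟦ combination c (projection ∘ s) ⟧ g ≡ 0ℙ
    vanish {zero}  c s off = refl
    vanish {suc m} c s off = cong₂ ℙ._+_ (trans (cong (c zero *_) (off zero)) (ℙₚ.*-zeroʳ (c zero)))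
                                         (vanish (c ∘ suc) (s ∘ suc) (off ∘ suc))
  combination-projection c s g (suc i) off on =
    cong₂ ℙ._+_ (trans (cong (c zero *_) (off zero λ ())) (ℙₚ.*-zeroʳ (c zero)))
                (combination-projection (c ∘ suc) (s ∘ suc) g i
                  (λ j j≢i → off (suc j) (j≢i ∘ suc-injective)) on)

  basis : Fin k → Vector Parity k
  basis i j with j ≟ i
  ... | yes _ = 1ℙ
  ... | no  _ = 0ℙ

  basis-on : ∀ i → basis i i ≡ 1ℙ
  basis-on i with i ≟ i
  ... | yes _  = refl
  ... | no i≢i = contradiction refl i≢i

  basis-off : ∀ i j → j ≢ i → basis i j ≡ 0ℙ
  basis-off i j j≢i with j ≟ i
  ... | yes j≡i = contradiction j≡i j≢i
  ... | no  _   = refl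

  -- The values of the combination at the basis of G depend surjectively on the
  -- coefficients in the finite set (ℤ₂)ᵏ, hence injectively.
  spanning⇒independent : (v : Vector (Hom k) k) → (∀ x → Span v x) → LinearlyIndependent v
  spanning⇒independent v spans c cv≈0 =
    surjective⇒injective coordinates coordinates-cong
      (λ w → proj₁ (spans (functional w)))
      (λ w i → trans (proj₂ (spans (functional w)) (basis i))
                     (combination-projection w id (basis i) i (basis-off i) (basis-on i)))
      λ i → trans (cv≈0 (basis i)) (sym (combination-0 v (basis i)))
    where
    coordinates : Vector Parity k → Vector Parity k
    coordinates c i = ⟦ combination c v ⟧ (basis i)
    coordinates-cong : ∀ {c d} → c ≗ d → coordinates c ≗ coordinates d
    coordinates-cong c≗d i = combination-congˡ v c≗d (basis i)
    functional : Vector Parity k → Hom k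
    functional w = combination w projection

-- Edges at a vertex of a 1-skeleton.

module _ {k n : ℕ} (S : AbstractSkeleton k n) where
  open AbstractSkeleton S
  open LinearAlgebra (HomSpace k)
  open Spans (HomSpace k)

  ∈-edgesAt⁺ : ∀ {p e} → Incident p e → e ∈ edgesAt p
  ∈-edgesAt⁺ {p} {e} inc = ∈-filter⁺ (incident? p) (∈-allFin e) inc

  ∈-edgesAt⁻ : ∀ {p e} → e ∈ edgesAt p → Incident p e
  ∈-edgesAt⁻ {p} e∈ = proj₂ (∈-filter⁻ (incident? p) {xs = allFin #edges} e∈)

  edgesAt-unique : ∀ p → Unique (edgesAt p)
  edgesAt-unique p = Unique.filter⁺ (incident? p) (Unique.allFin⁺ #edges)

  Joins⇒Incidentˡ : ∀ {e p q} → Joins e p q → Incident p e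
  Joins⇒Incidentˡ (inj₁ (refl , _)) = inj₁ refl
  Joins⇒Incidentˡ (inj₂ (_ , refl)) = inj₂ refl

  Joins⇒Incidentʳ : ∀ {e p q} → Joins e p q → Incident q e
  Joins⇒Incidentʳ j = Joins⇒Incidentˡ (swap j)

  Joins⇒≋ : ∀ {e p q} → Joins e p q → map α (edgesAt p) ≋ map α (edgesAt q) mod α e
  Joins⇒≋ {e} (inj₁ (refl , refl)) = congruent e
  Joins⇒≋ {e} (inj₂ (refl , refl)) = Permutation.↭-sym (quotient (α e)) (congruent e)

  module _ (F : Subgraph Γ) where
    open Subgraph F

    ∈-edgesAt∣⁺ : ∀ {p e} → e ∈ˢ edges → Incident p e → e ∈ edgesAt∣ p
    ∈-edgesAt∣⁺ e∈ inc = ∈-filter⁺ (_∈? edges) (∈-edgesAt⁺ inc) e∈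

    ∈-edgesAt∣⁻ : ∀ {p e} → e ∈ edgesAt∣ p → e ∈ˢ edges × Incident p e
    ∈-edgesAt∣⁻ {p} e∈ = let e∈p , e∈F = ∈-filter⁻ (_∈? edges) {xs = edgesAt p} e∈ in
      e∈F , ∈-edgesAt⁻ e∈p

    edgesAt∣-unique : ∀ p → Unique (edgesAt∣ p)
    edgesAt∣-unique p = Unique.filter⁺ (_∈? edges) (edgesAt-unique p)

  -- Existence of the face through the given edges.

  module Face {m : ℕ} (p : Vertex) (es : Fin m → Edge) (es-injective : Injective _≡_ _≡_ es)
              (es-incident : ∀ i → Incident p (es i))
              (closed : ∀ {e} → Incident p e → Span (α ∘ es) (α e) → ∃ λ i → e ≡ es i) where

    K : Pred (Hom k) 0ℓ
    K = Span (α ∘ es)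

    K-isSubspace : IsSubspace K
    K-isSubspace = Span-isSubspace (α ∘ es)

    K? : Decidable K
    K? = Span? (α ∘ es)

    edgesIn : Vertex → List Edge
    edgesIn q = filter (K? ∘ α) (edgesAt q)

    ∈-edgesIn⁺ : ∀ {q e} → Incident q e → K (α e) → e ∈ edgesIn q
    ∈-edgesIn⁺ inc = ∈-filter⁺ (K? ∘ α) (∈-edgesAt⁺ inc)

    ∈-edgesIn⁻ : ∀ {q e} → e ∈ edgesIn q → Incident q e × K (α e)
    ∈-edgesIn⁻ {q} e∈ = let e∈q , αe∈K = ∈-filter⁻ (K? ∘ α) {xs = edgesAt q} e∈ in
      ∈-edgesAt⁻ e∈q , αe∈K

    coloursIn : Vertex → List (Hom k)
    coloursIn q = map α (edgesIn q)

    coloursIn⊆K : ∀ {q x} → x ∈ coloursIn q → K x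
    coloursIn⊆K x∈ = let e , e∈ , x≡αe = ∈-map⁻ α x∈ in
      subst K (sym x≡αe) (proj₂ (∈-edgesIn⁻ e∈))

    coloursIn-≋ : ∀ {e q r} → Joins e q r → K (α e) → coloursIn q ≋ coloursIn r mod α e
    coloursIn-≋ {e} {q} {r} j αe∈K =
      subst₂ (_≋_mod α e) (filter-map K? α (edgesAt q)) (filter-map K? α (edgesAt r))
        (filter-mod K? K-isSubspace (α e) αe∈K (Joins⇒≋ j))

    -- The invariant carried along paths from `p`: its first half yields the valency of the face,
    -- its second half the spanning condition.
    Full : Vertex → Set
    Full q = length (edgesIn q) ≡ m × (∀ x → K x → Span (lookup (coloursIn q)) x)

    es∈edgesIn : ∀ i → es i ∈ edgesIn p
    es∈edgesIn i = ∈-edgesIn⁺ (es-incident i) (∈-Span (α ∘ es) i)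

    -- The hypothesis `closed` bounds the number of edges at `p` with colour in `K` by `m` from
    -- above, and injectivity of `es` bounds it from below.
    Full-p : Full p
    Full-p = ≤-antisym
        (covers⇒length≤ (Unique.filter⁺ (K? ∘ α) (edgesAt-unique p)) λ e∈ →
          let inc , αe∈K = ∈-edgesIn⁻ e∈ in closed inc αe∈K)
        (injective⇒length≥ es-injective es∈edgesIn)
      , Span-minimal (Span-isSubspace (lookup (coloursIn p))) {v = α ∘ es}
          λ i → ∈⇒Span (∈-map⁺ α (es∈edgesIn i))

    -- The congruence modulo `α e`, restricted to colours in `K`, preserves the count. It also
    -- transfers the span, since `e` is incident to `r` and so `α e` is among the colours at `r`.
    Full-step : ∀ {e q r} → Joins e q r → K (α e) → Full q → Full r
    Full-step {e} {q} {r} j αe∈K (len , spans) =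
        trans (sym (length-map α (edgesIn r)))
          (trans (sym (length-≋ (α e) q≋r))
            (trans (length-map α (edgesIn q)) len))
      , λ x → Span-mod (α e) q≋r (∈-map⁺ α (∈-edgesIn⁺ (Joins⇒Incidentʳ j) αe∈K)) x ∘ spans x
      where
      q≋r : coloursIn q ≋ coloursIn r mod α e
      q≋r = coloursIn-≋ j αe∈K

    AdjacentIn : Vertex → Vertex → Set
    AdjacentIn q r = ∃ λ e → K (α e) × Joins e q r

    adjacentIn? : Decidable₂ AdjacentIn
    adjacentIn? q r = any? λ e → K? (α e) ×-dec
      (((source e ≟ q) ×-dec (target e ≟ r)) ⊎-dec ((source e ≟ r) ×-dec (target e ≟ q)))

    C : Subset #vertices
    C = proj₁ (component adjacentIn? p)

    p∈C : p ∈ˢ C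
    p∈C = proj₁ (proj₂ (component adjacentIn? p))

    C-reachable : ∀ {q} → q ∈ˢ C → Star AdjacentIn p q
    C-reachable = proj₁ (proj₂ (proj₂ (component adjacentIn? p)))

    C-closed : ∀ {q r} → q ∈ˢ C → AdjacentIn q r → r ∈ˢ C
    C-closed = proj₂ (proj₂ (proj₂ (component adjacentIn? p)))

    -- Testing one endpoint is enough: `C` is closed under edges with colour in `K`, so it contains
    -- both endpoints of such an edge or neither.
    FaceEdge : Pred Edge 0ℓ
    FaceEdge e = K (α e) × source e ∈ˢ C

    faceEdge? : Decidable FaceEdge
    faceEdge? e = K? (α e) ×-dec (source e ∈? C)

    Incident⇒FaceEdge : ∀ {e q} → q ∈ˢ C → Incident q e → K (α e) → FaceEdge e
    Incident⇒FaceEdge     q∈C (inj₁ refl) αe∈K = αe∈K , q∈C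
    Incident⇒FaceEdge {e} q∈C (inj₂ refl) αe∈K = αe∈K , C-closed q∈C (e , αe∈K , inj₂ (refl , refl))

    face : Subgraph Γ
    face = record
      { vertices = C
      ; edges    = ⟪ faceEdge? ⟫
      ; source∈  = λ e∈ → proj₂ (∈⟪⟫⁻ faceEdge? e∈)
      ; target∈  = λ {e} e∈ → let αe∈K , s∈C = ∈⟪⟫⁻ faceEdge? e∈ in
                     C-closed s∈C (e , αe∈K , inj₁ (refl , refl))
      }

    open Subgraph face using (edgesAt∣; Adjacent)

    -- Both sides filter `edgesAt q`, by predicates that agree on it. Equality of lists, not merely
    -- of sets, lets valency, span and congruence be transported by `subst`.
    face-edgesAt : ∀ {q} → q ∈ˢ C → edgesAt∣ q ≡ edgesIn q
    face-edgesAt q∈C = filter-cong (_∈? ⟪ faceEdge? ⟫) (K? ∘ α) λ e∈ → mk⇔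
      (λ e∈F → proj₁ (∈⟪⟫⁻ faceEdge? e∈F))
      (λ αe∈K → ∈⟪⟫⁺ faceEdge? (Incident⇒FaceEdge q∈C (∈-edgesAt⁻ e∈) αe∈K))

    C-full : ∀ {q} → q ∈ˢ C → Full q
    C-full q∈C = along (C-reachable q∈C) Full-p
      where
      along : ∀ {q r} → Star AdjacentIn q r → Full q → Full r
      along ε                      full = full
      along ((_ , αe∈K , j) ◅ rest) full = along rest (Full-step j αe∈K full)

    face-path : ∀ {q r} → q ∈ˢ C → Star AdjacentIn q r → Star Adjacent q r
    face-path q∈C ε = ε
    face-path q∈C ((e , αe∈K , j) ◅ rest) =
      (e , ∈⟪⟫⁺ faceEdge? (Incident⇒FaceEdge q∈C (Joins⇒Incidentˡ j) αe∈K) , j)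
        ◅ face-path (C-closed q∈C (e , αe∈K , j)) rest

    Adjacent-sym : Symmetric Adjacent
    Adjacent-sym (e , e∈ , j) = e , e∈ , swap j

    face-isFace : IsFace S m face
    face-isFace = record
      -- Any two vertices are joined through `p`: back along the path to the first, then out to the
      -- second.
      { connected  = (p , p∈C) , λ q∈C r∈C →
          Star.reverse Adjacent-sym (face-path p∈C (C-reachable q∈C)) ◅◅ face-path p∈C (C-reachable r∈C)
      ; d-valent   = λ q∈C → trans (cong length (face-edgesAt q∈C)) (proj₁ (C-full q∈C))
      ; K          = K
      ; isSubspace = K-isSubspace
      ; spanning∣  = λ {q} q∈C → subst (λ es → map α es Spans K) (sym (face-edgesAt q∈C)) λ x →
          mk⇔ (proj₂ (C-full q∈C) x) (All⇒Span⊆ K-isSubspace coloursIn⊆K x)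
      ; congruent∣ = λ {e} e∈ →
          let αe∈K , s∈C = ∈⟪⟫⁻ faceEdge? e∈
              j : Joins e (source e) (target e)
              j = inj₁ (refl , refl)
          in subst₂ (λ es es′ → map α es ≋ map α es′ mod α e)
               (sym (face-edgesAt s∈C)) (sym (face-edgesAt (C-closed s∈C (e , αe∈K , j))))
               (coloursIn-≋ j αe∈K)
      }

    -- Uniqueness of the face.

    module _ (F : Subgraph Γ) (isFace : IsFace S m F) (p∈F : p ∈ˢ Subgraph.vertices F)
             (es∈F : ∀ i → es i ∈ˢ Subgraph.edges F) where
      open Subgraph F using () renaming (vertices to vertices′; edges to edges′;
        source∈ to source∈′; target∈ to target∈′; edgesAt∣ to edgesAt∣′; Adjacent to Adjacent′)
      open IsFace isFace using (connected; d-valent; spanning∣) renaming (K to K′)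

      -- `F` has `m` edges at `p`, among them the `m` distinct edges `es`, hence no others; and the
      -- colours of these edges span `K′`.
      K′⊆K : ∀ x → K′ x → K x
      K′⊆K x x∈K′ = All⇒Span⊆ K-isSubspace colour∈K x
        (Equivalence.to (spanning∣ p∈F x) x∈K′)
        where
        colour∈K : ∀ {x} → x ∈ map α (edgesAt∣′ p) → K x
        colour∈K x∈ =
          let e , e∈ , x≡αe = ∈-map⁻ α x∈
              i , e≡esᵢ = injective⇒covers _≟_ es-injective
                            (λ i → ∈-edgesAt∣⁺ F (es∈F i) (es-incident i))
                            (≤-reflexive (d-valent p∈F)) e∈
          in subst K (sym (trans x≡αe (cong α e≡esᵢ))) (∈-Span (α ∘ es) i)

      edges′-in-K : ∀ {e} → e ∈ˢ edges′ → K (α e)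
      edges′-in-K {e} e∈F = K′⊆K (α e) (Equivalence.from (spanning∣ (source∈′ e∈F) (α e))
        (∈⇒Span (∈-map⁺ α (∈-edgesAt∣⁺ F e∈F (inj₁ refl)))))

      -- `F` is connected and its edges have colours in `K`, so a path in `F` starting at `p` never
      -- leaves `C`.
      vertices′⊆C : vertices′ ⊆ˢ C
      vertices′⊆C q∈F = along p∈C (proj₂ connected p∈F q∈F)
        where
        along : ∀ {q r} → q ∈ˢ C → Star Adjacent′ q r → r ∈ˢ C
        along q∈C ε = q∈C
        along q∈C ((e , e∈ , j) ◅ rest) = along (C-closed q∈C (e , edges′-in-K e∈ , j)) rest

      -- The edges of `F` at `q` are among those with colour in `K`, and there are `m` of either
      -- kind, by valency of `F` and by `C-full`.
      edgesIn⊆edges′ : ∀ {q e} → q ∈ˢ vertices′ → Incident q e → K (α e) → e ∈ˢ edges′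
      edgesIn⊆edges′ {q} q∈F inc αe∈K = proj₁ (∈-edgesAt∣⁻ F
        (Unique∧⊆∧length≥⇒⊇ _≟_ (edgesAt∣-unique F q)
          (λ e∈ → let e∈F , inc = ∈-edgesAt∣⁻ F e∈ in ∈-edgesIn⁺ inc (edges′-in-K e∈F))
          (≤-reflexive (trans (proj₁ (C-full (vertices′⊆C q∈F))) (sym (d-valent q∈F))))
          (∈-edgesIn⁺ inc αe∈K)))

      Joins⇒∈ : ∀ {e q r} → Joins e q r → e ∈ˢ edges′ → r ∈ˢ vertices′
      Joins⇒∈ (inj₁ (_ , refl)) e∈ = target∈′ e∈
      Joins⇒∈ (inj₂ (refl , _)) e∈ = source∈′ e∈

      -- By `edgesIn⊆edges′`, a path of edges with colours in `K` that starts in `F` uses only edges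
      -- of `F`.
      C⊆vertices′ : C ⊆ˢ vertices′
      C⊆vertices′ q∈C = along p∈F (C-reachable q∈C)
        where
        along : ∀ {q r} → q ∈ˢ vertices′ → Star AdjacentIn q r → r ∈ˢ vertices′
        along q∈F ε = q∈F
        along q∈F ((e , αe∈K , j) ◅ rest) =
          along (Joins⇒∈ j (edgesIn⊆edges′ q∈F (Joins⇒Incidentˡ j) αe∈K)) rest

      face-unique : face ≈ˢ F
      face-unique = ⊆-antisym C⊆vertices′ vertices′⊆C , ⊆-antisym
        (λ e∈ → let αe∈K , s∈C = ∈⟪⟫⁻ faceEdge? e∈ in
          edgesIn⊆edges′ (C⊆vertices′ s∈C) (inj₁ refl) αe∈K)
        (λ e∈F → ∈⟪⟫⁺ faceEdge? (edges′-in-K e∈F , vertices′⊆C (source∈′ e∈F)))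

    extendsToUniqueFace : ExtendsToUniqueFace S p es
    extendsToUniqueFace = face
      , (face-isFace , p∈C , λ i → ∈⟪⟫⁺ faceEdge?
          (Incident⇒FaceEdge p∈C (es-incident i) (∈-Span (α ∘ es) i)))
      , λ {F} (isFace , p∈F , es∈F) → face-unique F isFace p∈F es∈F

  -- Independence of the colours at a vertex.

  newEdge : ∀ {m} → m < n → ∀ p (es : Fin m → Edge) → ∃ λ e → Incident p e × (∀ i → e ≢ es i)
  newEdge {m} m<n p es = decidable-stable
    (any? λ e → incident? p e ×-dec all? λ i → ¬? (e ≟ es i)) λ none →
      <⇒≱ m<n (subst (_≤ m) (regular p) (covers⇒length≤ (edgesAt-unique p) λ {e} e∈ →
        decidable-stable (any? λ i → e ≟ es i) λ e∉es →
          none (e , ∈-edgesAt⁻ e∈ , λ i e≡ → e∉es (i , e≡))))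

  cons-incident : ∀ {m p e} {es : Fin m → Edge} → Incident p e → (∀ i → Incident p (es i)) →
                  ∀ i → Incident p ((e Vector.∷ es) i)
  cons-incident inc incs zero    = inc
  cons-incident inc incs (suc i) = incs i

  -- A family of `l` edges is enlarged by one more edge with coefficient 0. The bound `l < n`
  -- provides that edge; for `l = n` the hypothesis would be vacuous, as no vertex has `n + 1`
  -- edges.
  Independent-pred : ∀ {l} → l < n → Independent S (suc l) → Independent S l
  Independent-pred l<n indep p es es-inj es-inc c c≈0 i =
    let e , inc , e∉es = newEdge l<n p es in
    indep p (e Vector.∷ es) (∷-injective-family e∉es es-inj) (cons-incident inc es-inc)
      (0ℙ Vector.∷ c) c≈0 (suc i)

  Independent-≤ : ∀ {l m} → m ≤′ l → l ≤ n → Independent S l → Independent S m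
  Independent-≤ ≤′-refl        l≤n indep = indep
  Independent-≤ (≤′-step m≤′l) l<n indep = Independent-≤ m≤′l (<⇒≤ l<n) (Independent-pred l<n indep)

  -- If `e` were a new edge, then writing `α e` as a combination of the other colours would give, in
  -- characteristic 2, a vanishing combination of `m + 1` colours with coefficient 1 at `e`.
  Independent⇒closed : ∀ {m} → Independent S (suc m) → ∀ {p} {es : Fin m → Edge} →
    Injective _≡_ _≡_ es → (∀ i → Incident p (es i)) →
    ∀ {e} → Incident p e → Span (α ∘ es) (α e) → ∃ λ i → e ≡ es i
  Independent⇒closed indep {p} {es} es-inj es-inc {e} inc (c , c≈αe) =
    decidable-stable (any? λ i → e ≟ es i) λ e∉es →
      contradiction
        (indep p (e Vector.∷ es) (∷-injective-family (λ i e≡ → e∉es (i , e≡)) es-inj)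
          (cons-incident inc es-inc) (1ℙ Vector.∷ c)
          (λ g → trans (cong (⟦ α e ⟧ g ℙ.+_) (c≈αe g)) (ℙₚ.p+p≡0ℙ (⟦ α e ⟧ g))) zero)
        λ ()
    where open GroupHomomorphism using (⟦_⟧)

  full-family-covers : ∀ {p} {es : Fin n → Edge} → Injective _≡_ _≡_ es →
                       (∀ i → Incident p (es i)) → ∀ {e} → Incident p e → ∃ λ i → e ≡ es i
  full-family-covers {p} es-inj es-inc inc = injective⇒covers _≟_ es-inj
    (λ i → ∈-edgesAt⁺ (es-inc i)) (≤-reflexive (regular p)) (∈-edgesAt⁺ inc)

  -- Any `n` distinct edges at `p` are all the edges at `p`, so their colours span; as `k = n`, a
  -- spanning family of this size is independent.
  independent-of-minimal-valency : k ≡ n → Independent S n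
  independent-of-minimal-valency refl p es es-inj es-inc = spanning⇒independent (α ∘ es) λ x →
    All⇒Span⊆ (Span-isSubspace (α ∘ es)) colour∈Span x
      (Equivalence.to (spanning p x) _)
    where
    colour∈Span : ∀ {x} → x ∈ map α (edgesAt p) → Span (α ∘ es) x
    colour∈Span x∈ =
      let e , e∈ , x≡αe = ∈-map⁻ α x∈
          i , e≡esᵢ = full-family-covers es-inj es-inc (∈-edgesAt⁻ e∈)
      in subst (Span (α ∘ es)) (sym (trans x≡αe (cong α e≡esᵢ))) (∈-Span (α ∘ es) i)

proposition3p1 : (k n : ℕ) → 1 ≤ k → (S : AbstractSkeleton k n) →
    let open AbstractSkeleton S in
    ((l : ℕ) → 1 < l → l ≤ k → Independent S l →
    (m : ℕ) → m < l → (p : Vertex) (es : Fin m → Edge) →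
    Injective _≡_ _≡_ es → (∀ i → Incident p (es i)) →
    ExtendsToUniqueFace S p es)
    ×
    (k ≡ n →
    (m : ℕ) → m ≤ n → (p : Vertex) (es : Fin m → Edge) →
    Injective _≡_ _≡_ es → (∀ i → Incident p (es i)) →
    ExtendsToUniqueFace S p es)
proposition3p1 k n _ S = independent-case , minimal-case
  where
  open AbstractSkeleton S using (Vertex; Edge; Incident; k≤n)

  below : ∀ {l} → l ≤ n → Independent S l → ∀ {m} → m < l → (p : Vertex) (es : Fin m → Edge) →
          Injective _≡_ _≡_ es → (∀ i → Incident p (es i)) → ExtendsToUniqueFace S p es
  below l≤n indep m<l p es es-inj es-inc = Face.extendsToUniqueFace S p es es-inj es-inc
    -- Since `m < l` means `suc m ≤ l`, independence descends to families of `m + 1` edges: the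
    -- given ones and one possible intruder.
    (Independent⇒closed S (Independent-≤ S (≤⇒≤′ m<l) l≤n indep) es-inj es-inc)

  independent-case : (l : ℕ) → 1 < l → l ≤ k → Independent S l →
    (m : ℕ) → m < l → (p : Vertex) (es : Fin m → Edge) →
    Injective _≡_ _≡_ es → (∀ i → Incident p (es i)) → ExtendsToUniqueFace S p es
  independent-case l _ l≤k indep m = below (≤-trans l≤k k≤n) indep

  minimal-case : k ≡ n → (m : ℕ) → m ≤ n → (p : Vertex) (es : Fin m → Edge) →
    Injective _≡_ _≡_ es → (∀ i → Incident p (es i)) → ExtendsToUniqueFace S p es
  minimal-case k≡n m m≤n with m≤n⇒m<n∨m≡n m≤n
  ... | inj₁ m<n  = below ≤-refl (independent-of-minimal-valency S k≡n) m<n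
  -- Here the given edges are all the edges at `p`, so no further edge can have its colour in their
  -- span.
  ... | inj₂ refl = λ p es es-inj es-inc → Face.extendsToUniqueFace S p es es-inj es-inc
    λ inc _ → full-family-covers S es-inj es-inc inc
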